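{- Let $Q(n)$ be the number of $n$-quasigroups of order $4$ on the set $A=\{0,1,2,3\}$. Then for every natural number $n\ge 1$, $$Q(n) \leq 4^{3^n} = 2^{2^{(\log_2 3)\, n+1}}.$$
   Context: Let $A=\{0,1,2,3\}$. For a natural number $n$, an $n$-quasigroup (of order $4$) is a pair $(A,q)$ where $q:A^n\to A$ satisfies $q(c)\neq q(c')$ for all $c,c'\in A^n$ that differ in exactly one coordinate. $Q(n)$ denotes the number of different $n$-quasigroups $(A,q)$, i.e. the number of such maps $q$ (not up to equivalence). -}

module Defs where

open import Data.Empty using (⊥-elim)
open import Data.Fin using (Fin; zero; suc; finToFun; funToFin; combine)
open import Data.Fin.Properties using (all?; any?; funToFin-finToFin; finToFun-funToFin)
import Data.Fin.Properties as Fin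
open import Data.Integer using (ℤ; +_; -[1+_])
import Data.Integer as ℤ
import Data.Integer.Properties as ℤ
open import Data.List using (List; []; _∷_; length; filter; allFin)
import Data.List as List
open import Data.List.Membership.Propositional using (_∈_)
open import Data.List.Membership.Propositional.Properties using (∈-filter⁺; ∈-filter⁻; ∈-allFin; ∈-lookup)
open import Data.List.Relation.Unary.All using (All)
import Data.List.Relation.Unary.All as All
import Data.List.Relation.Unary.All.Properties as All
open import Data.List.Relation.Unary.AllPairs using (_∷_)
open import Data.List.Relation.Unary.Any using (index)
import Data.List.Relation.Unary.Any.Properties as Any
open import Data.List.Relation.Unary.Unique.Propositional using (Unique)
import Data.List.Relation.Unary.Unique.Propositional.Properties as Unique
open import Data.Nat
open import Data.Nat.Properties
open import Data.Nat.Solver using (module +-*-Solver)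
open import Data.Product using (Σ; ∃; ∃-syntax; ∃!; _×_; _,_; proj₁; proj₂)
open import Data.Rational.Unnormalised using (ℚᵘ; mkℚᵘ; 0ℚᵘ; 1ℚᵘ; ½; *≤*; *<*; ↥_; ↧_; ↧ₙ_)
import Data.Rational.Unnormalised as ℚ
import Data.Rational.Unnormalised.Properties as ℚ
open import Data.Vec using (Vec; []; _∷_; lookup; tabulate)
open import Data.Vec.Properties using (lookup∘tabulate; tabulate∘lookup; tabulate-cong)
open import Function using (_∘_; Bijection)
open import Level using (0ℓ)
open import Relation.Binary using (Setoid)
open import Relation.Binary.PropositionalEquality
open import Relation.Nullary using (Dec; ¬_; yes; no; contradiction)
open import Relation.Nullary.Decidable using (map′; ¬?; _→-dec_; _×-dec_)
open import Relation.Unary using (Pred; Decidable)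

open import Algebra.Definitions.RawSemiring ℚ.+-*-rawSemiring using ()
  renaming (_^_ to _^ℚ_)

------------------------------------------------------------------------
-- n-quasigroups of order 4

A : Set
A = Fin 4

DifferInExactlyOne : ∀ {n} → Vec A n → Vec A n → Set
DifferInExactlyOne c c′ = ∃! _≡_ (λ i → lookup c i ≢ lookup c′ i)

IsQuasigroup : ∀ {n} → (Vec A n → A) → Set
IsQuasigroup q = ∀ c c′ → DifferInExactlyOne c c′ → q c ≢ q c′

-- Two quasigroups are the same when their operations agree pointwise:
-- function extensionality is not available.
quasigroupSetoid : ℕ → Setoid 0ℓ 0ℓ
quasigroupSetoid n = record
  { Carrier       = Σ (Vec A n → A) IsQuasigroup
  ; _≈_           = λ q q′ → proj₁ q ≗ proj₁ q′
  ; isEquivalence = record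
    { refl  = λ _ → refl
    ; sym   = λ eq c → sym (eq c)
    ; trans = λ eq eq′ c → trans (eq c) (eq′ c)
    }
  }

allVec? : ∀ n {P : Pred (Vec A n) 0ℓ} → Decidable P → Dec (∀ v → P v)
allVec? zero    P? = map′ (λ p → λ { [] → p }) (λ f → f []) (P? [])
allVec? (suc n) P? =
  map′ (λ f → λ { (a ∷ v) → f a v }) (λ f a v → f (a ∷ v))
       (all? (λ a → allVec? n (λ v → P? (a ∷ v))))

differInExactlyOne? : ∀ {n} (c c′ : Vec A n) → Dec (DifferInExactlyOne c c′)
differInExactlyOne? c c′ =
  any? (λ i → D? i ×-dec map′ (λ f {j} → f j) (λ f j → f {j})
                              (all? (λ j → D? j →-dec (i Fin.≟ j))))
  where
  D? : Decidable (λ i → lookup c i ≢ lookup c′ i)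
  D? i = ¬? (lookup c i Fin.≟ lookup c′ i)

isQuasigroup? : ∀ {n} (q : Vec A n → A) → Dec (IsQuasigroup q)
isQuasigroup? {n} q =
  allVec? n (λ c → allVec? n (λ c′ →
    differInExactlyOne? c c′ →-dec ¬? (q c Fin.≟ q c′)))

-- The value table of a map Aⁿ → A has 4ⁿ entries in A, so such maps are
-- numbered by Fin (4 ^ (4 ^ n)).
fromCode : ∀ n → Fin (4 ^ (4 ^ n)) → Vec A n → A
fromCode n t c = finToFun t (funToFin (lookup c))

quasigroupCodes : ∀ n → List (Fin (4 ^ (4 ^ n)))
quasigroupCodes n = filter (isQuasigroup? ∘ fromCode n) (allFin (4 ^ (4 ^ n)))

Q : ℕ → ℕ
Q n = length (quasigroupCodes n)

funToFin-cong : ∀ {m n} {f g : Fin m → Fin n} → f ≗ g → funToFin f ≡ funToFin g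
funToFin-cong {zero}  f≗g = refl
funToFin-cong {suc m} f≗g = cong₂ combine (f≗g zero) (funToFin-cong (f≗g ∘ suc))

fromCode-injective : ∀ n t t′ → fromCode n t ≗ fromCode n t′ → t ≡ t′
fromCode-injective n t t′ eq =
  trans (sym (funToFin-finToFin {4 ^ n} {4} t))
        (trans (funToFin-cong same) (funToFin-finToFin {4 ^ n} {4} t′))
  where
  point : Fin (4 ^ n) → Vec A n
  point i = tabulate (finToFun i)
  funToFin-point : ∀ i → funToFin (lookup (point i)) ≡ i
  funToFin-point i = trans (funToFin-cong {n} {4} (lookup∘tabulate (finToFun i)))
                           (funToFin-finToFin {n} {4} i)
  same : finToFun {4} {4 ^ n} t ≗ finToFun t′
  same i = trans (cong (finToFun t) (sym (funToFin-point i)))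
                 (trans (eq (point i)) (cong (finToFun t′) (funToFin-point i)))

tabulate-finToFun : ∀ {n} (c : Vec A n) → tabulate (finToFun (funToFin (lookup c))) ≡ c
tabulate-finToFun c =
  trans (tabulate-cong (finToFun-funToFin (lookup c))) (tabulate∘lookup c)

toCode : ∀ n → (Vec A n → A) → Fin (4 ^ (4 ^ n))
toCode n q = funToFin (λ i → q (tabulate (finToFun i)))

fromCode-toCode : ∀ n q → fromCode n (toCode n q) ≗ q
fromCode-toCode n q c =
  trans (finToFun-funToFin (λ i → q (tabulate (finToFun i))) (funToFin (lookup c)))
        (cong q (tabulate-finToFun c))

lookup-injective : ∀ {B : Set} {xs : List B} → Unique xs →
                   ∀ i j → List.lookup xs i ≡ List.lookup xs j → i ≡ j
lookup-injective (_ ∷ _)  zero    zero    _  = refl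
lookup-injective (p ∷ _)  zero    (suc j) eq =
  contradiction eq (All.lookup p (∈-lookup j))
lookup-injective (p ∷ _)  (suc i) zero    eq =
  contradiction (sym eq) (All.lookup p (∈-lookup i))
lookup-injective (_ ∷ ps) (suc i) (suc j) eq = cong suc (lookup-injective ps i j eq)

-- filter and allFin make Q n computable; this shows that it counts what it
-- should, each quasigroup once.
Q-counts : ∀ n → Bijection (setoid (Fin (Q n))) (quasigroupSetoid n)
Q-counts n = record
  { to        = to
  ; cong      = λ { refl c → refl }
  ; bijective = (λ {i} {j} eq → lookup-injective unique i j
                                  (fromCode-injective n _ _ eq))
              , λ { (q , qg) → index (member q qg) , λ { refl c →
                    trans (cong (λ t → fromCode n t c)
                                (sym (Any.lookup-index (member q qg))))
                          (fromCode-toCode n q c) } }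
  }
  where
  P? = isQuasigroup? ∘ fromCode n
  to : Fin (Q n) → Σ (Vec A n → A) IsQuasigroup
  to i = fromCode n (List.lookup (quasigroupCodes n) i)
       , proj₂ (∈-filter⁻ P? {xs = allFin (4 ^ (4 ^ n))} (∈-lookup i))
  unique : Unique (quasigroupCodes n)
  unique = Unique.filter⁺ P? (Unique.allFin⁺ _)
  member : ∀ q → IsQuasigroup q → toCode n q ∈ quasigroupCodes n
  member q qg = ∈-filter⁺ P? (∈-allFin _)
    (λ c c′ d e → qg c c′ d
      (trans (sym (fromCode-toCode n q c)) (trans e (fromCode-toCode n q c′))))

------------------------------------------------------------------------
-- Positive real numbers

-- A positive real is a Dedekind cut, given by the set of positive rationals
-- lying strictly below it; two reals are equal when these sets coincide.
-- Sets are predicates into Set, and no decidability is required of them.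
record ℝ⁺ : Set₁ where
  field
    Below     : ℚᵘ → Set
    positive  : ∀ {q} → Below q → 0ℚᵘ ℚ.< q
    inhabited : ∃ Below
    bounded   : ∃[ B ] (∀ {q} → Below q → q ℚ.< B)
    downward  : ∀ {p q} → 0ℚᵘ ℚ.< p → p ℚ.≤ q → Below q → Below p
    rounded   : ∀ {q} → Below q → ∃[ r ] (q ℚ.< r × Below r)

open ℝ⁺

infix 4 _≈_
_≈_ : ℝ⁺ → ℝ⁺ → Set
x ≈ y = ∀ q → (Below x q → Below y q) × (Below y q → Below x q)

½>0 : 0ℚᵘ ℚ.< ½
½>0 = *<* (ℤ.+<+ (s≤s z≤n))

+-pos : ∀ {p q} → 0ℚᵘ ℚ.< p → 0ℚᵘ ℚ.< q → 0ℚᵘ ℚ.< p ℚ.+ q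
+-pos {p} {q} hp hq =
  ℚ.positive⁻¹ (p ℚ.+ q) {{ℚ.pos+pos⇒pos p {{ℚ.positive hp}} q {{ℚ.positive hq}}}}

*-pos : ∀ {p q} → 0ℚᵘ ℚ.< p → 0ℚᵘ ℚ.< q → 0ℚᵘ ℚ.< p ℚ.* q
*-pos {p} {q} hp hq =
  ℚ.positive⁻¹ (p ℚ.* q) {{ℚ.pos*pos⇒pos p {{ℚ.positive hp}} q {{ℚ.positive hq}}}}

*-mono-<-pos : ∀ {p p′ q q′} → 0ℚᵘ ℚ.< p → 0ℚᵘ ℚ.< q →
               p ℚ.< p′ → q ℚ.< q′ → p ℚ.* q ℚ.< p′ ℚ.* q′
*-mono-<-pos {p} {q = q} hp hq = ℚ.*-mono-<-nonNeg
  {{ℚ.pos⇒nonNeg p {{ℚ.positive hp}}}} {{ℚ.pos⇒nonNeg q {{ℚ.positive hq}}}}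

infixl 6 _+ℝ_
_+ℝ_ : ℝ⁺ → ℝ⁺ → ℝ⁺
x +ℝ y = record
  { Below     = λ q → 0ℚᵘ ℚ.< q × ∃[ r ] ∃[ s ] (Below x r × Below y s × q ℚ.≤ r ℚ.+ s)
  ; positive  = proj₁
  ; inhabited = let r , hr = inhabited x; s , hs = inhabited y in
      r ℚ.+ s , +-pos (positive x hr) (positive y hs) , r , s , hr , hs , ℚ.≤-refl
  ; bounded   = let B , hB = bounded x; C , hC = bounded y in
      B ℚ.+ C , λ { (_ , r , s , hr , hs , q≤) →
        ℚ.≤-<-trans q≤ (ℚ.+-mono-< (hB hr) (hC hs)) }
  ; downward  = λ { p>0 p≤q (_ , r , s , hr , hs , q≤) →
      p>0 , r , s , hr , hs , ℚ.≤-trans p≤q q≤ }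
  ; rounded   = λ { (_ , r , s , hr , hs , q≤) →
      let r′ , r<r′ , hr′ = rounded x hr; s′ , s<s′ , hs′ = rounded y hs in
      r′ ℚ.+ s′ , ℚ.≤-<-trans q≤ (ℚ.+-mono-< r<r′ s<s′)
      , +-pos (positive x hr′) (positive y hs′) , r′ , s′ , hr′ , hs′ , ℚ.≤-refl }
  }

infixl 7 _*ℝ_
_*ℝ_ : ℝ⁺ → ℝ⁺ → ℝ⁺
x *ℝ y = record
  { Below     = λ q → 0ℚᵘ ℚ.< q × ∃[ r ] ∃[ s ] (Below x r × Below y s × q ℚ.≤ r ℚ.* s)
  ; positive  = proj₁
  ; inhabited = let r , hr = inhabited x; s , hs = inhabited y in
      r ℚ.* s , *-pos (positive x hr) (positive y hs) , r , s , hr , hs , ℚ.≤-refl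
  ; bounded   = let B , hB = bounded x; C , hC = bounded y in
      B ℚ.* C , λ { (_ , r , s , hr , hs , q≤) →
        ℚ.≤-<-trans q≤ (*-mono-<-pos (positive x hr) (positive y hs) (hB hr) (hC hs)) }
  ; downward  = λ { p>0 p≤q (_ , r , s , hr , hs , q≤) →
      p>0 , r , s , hr , hs , ℚ.≤-trans p≤q q≤ }
  ; rounded   = λ { (_ , r , s , hr , hs , q≤) →
      let r′ , r<r′ , hr′ = rounded x hr; s′ , s<s′ , hs′ = rounded y hs in
      r′ ℚ.* s′
      , ℚ.≤-<-trans q≤ (*-mono-<-pos (positive x hr) (positive y hs) r<r′ s<s′)
      , *-pos (positive x hr′) (positive y hs′) , r′ , s′ , hr′ , hs′ , ℚ.≤-refl }
  }

≤-toℕ : ∀ {a b c d} → mkℚᵘ (+ a) b ℚ.≤ mkℚᵘ (+ c) d → a * suc d ≤ c * suc b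
≤-toℕ {a} {b} {c} {d} (*≤* h) =
  ℤ.drop‿+≤+ (subst₂ ℤ._≤_ (sym (ℤ.pos-* a (suc d))) (sym (ℤ.pos-* c (suc b))) h)

≤-fromℕ : ∀ {a b c d} → a * suc d ≤ c * suc b → mkℚᵘ (+ a) b ℚ.≤ mkℚᵘ (+ c) d
≤-fromℕ {a} {b} {c} {d} h =
  *≤* (subst₂ ℤ._≤_ (ℤ.pos-* a (suc d)) (ℤ.pos-* c (suc b)) (ℤ.+≤+ h))

<-toℕ : ∀ {a b c d} → mkℚᵘ (+ a) b ℚ.< mkℚᵘ (+ c) d → a * suc d < c * suc b
<-toℕ {a} {b} {c} {d} (*<* h) =
  ℤ.drop‿+<+ (subst₂ ℤ._<_ (sym (ℤ.pos-* a (suc d))) (sym (ℤ.pos-* c (suc b))) h)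

<-fromℕ : ∀ {a b c d} → a * suc d < c * suc b → mkℚᵘ (+ a) b ℚ.< mkℚᵘ (+ c) d
<-fromℕ {a} {b} {c} {d} h =
  *<* (subst₂ ℤ._<_ (ℤ.pos-* a (suc d)) (ℤ.pos-* c (suc b)) (ℤ.+<+ h))

pos-mk : ∀ {a b} → 0 < a → 0ℚᵘ ℚ.< mkℚᵘ (+ a) b
pos-mk h = <-fromℕ (subst (0 <_) (sym (*-identityʳ _)) h)

pow-cancel-≤ : ∀ n {a b} → a ^ suc n ≤ b ^ suc n → a ≤ b
pow-cancel-≤ n {a} {b} h with a ≤? b
... | yes p = p
... | no ¬p = contradiction h (<⇒≱ (^-monoˡ-< (suc n) (≰⇒> ¬p)))

pow-cancel-< : ∀ n {a b} → a ^ n < b ^ n → a < b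
pow-cancel-< n {a} {b} h with a <? b
... | yes p = p
... | no ¬p = contradiction h (≤⇒≯ (^-monoˡ-≤ n (≮⇒≥ ¬p)))

exp-cancel-< : ∀ {a b} → 2 ^ a < 2 ^ b → a < b
exp-cancel-< {a} {b} h with a <? b
... | yes p = p
... | no ¬p = contradiction h (≤⇒≯ (^-monoʳ-≤ 2 (≮⇒≥ ¬p)))

n<2^n : ∀ n → n < 2 ^ n
n<2^n zero    = s≤s z≤n
n<2^n (suc n) = begin-strict
  suc n           ≡⟨ +-comm 1 n ⟩
  n + 1           <⟨ +-mono-<-≤ (n<2^n n) (m^n>0 2 n) ⟩
  2 ^ n + 2 ^ n   ≡⟨ cong (_+_ (2 ^ n)) (sym (+-identityʳ (2 ^ n))) ⟩
  2 ^ suc n       ∎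
  where open ≤-Reasoning

swap-exp : ∀ m a b → (m ^ a) ^ b ≡ (m ^ b) ^ a
swap-exp m a b = trans (^-*-assoc m a b) (trans (cong (m ^_) (*-comm a b)) (sym (^-*-assoc m b a)))

^-distribʳ : ∀ a b n → (a * b) ^ n ≡ a ^ n * b ^ n
^-distribʳ a b zero    = refl
^-distribʳ a b (suc n) = trans (cong (_*_ (a * b)) (^-distribʳ a b n))
  (solve 4 (λ a b x y → a :* b :* (x :* y) := (a :* x) :* (b :* y)) refl a b (a ^ n) (b ^ n))
  where open +-*-Solver

bernoulli : ∀ x n → x ^ n * (x + n) ≤ suc x ^ n * x
bernoulli x zero    = ≤-reflexive (cong (1 *_) (+-identityʳ x))
bernoulli x (suc n) = begin
  x * x ^ n * (x + suc n)     ≡⟨ lhs ⟩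
  x ^ n * (x * (x + suc n))   ≤⟨ *-monoʳ-≤ (x ^ n) step ⟩
  x ^ n * (suc x * (x + n))   ≡⟨ mid ⟩
  suc x * (x ^ n * (x + n))   ≤⟨ *-monoʳ-≤ (suc x) (bernoulli x n) ⟩
  suc x * (suc x ^ n * x)     ≡⟨ *-assoc (suc x) (suc x ^ n) x ⟨
  suc x * suc x ^ n * x       ∎
  where
  open ≤-Reasoning
  open +-*-Solver
  lhs = solve 3 (λ x p s → x :* p :* s := p :* (x :* s)) refl x (x ^ n) (x + suc n)
  mid = solve 3 (λ x p s → p :* (x :* s) := x :* (p :* s)) refl (suc x) (x ^ n) (x + n)
  step : x * (x + suc n) ≤ suc x * (x + n)
  step = subst (x * (x + suc n) ≤_)
    (solve 2 (λ x n → x :* (x :+ (con 1 :+ n)) :+ n := (con 1 :+ x) :* (x :+ n)) refl x n)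
    (m≤m+n _ n)

2x^x≤[1+x]^x : ∀ x .{{_ : NonZero x}} → 2 * x ^ x ≤ suc x ^ x
2x^x≤[1+x]^x x = *-cancelʳ-≤ _ _ x (subst (_≤ suc x ^ x * x)
  (solve 2 (λ x p → p :* (x :+ x) := con 2 :* p :* x) refl x (x ^ x)) (bernoulli x x))
  where open +-*-Solver

bernoulli⁻ : ∀ y k j → k + j ≡ suc y → suc y ^ k * j ≤ y ^ k * suc y
bernoulli⁻ y zero    j eq = ≤-reflexive (cong (1 *_) eq)
bernoulli⁻ y (suc k) j eq = begin
  suc y * suc y ^ k * j       ≡⟨ solve 3 (λ a p j → a :* p :* j := p :* (a :* j)) refl (suc y) (suc y ^ k) j ⟩
  suc y ^ k * (suc y * j)     ≤⟨ *-monoʳ-≤ (suc y ^ k) step ⟩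
  suc y ^ k * (suc j * y)     ≡⟨ *-assoc (suc y ^ k) (suc j) y ⟨
  suc y ^ k * suc j * y       ≤⟨ *-monoˡ-≤ y (bernoulli⁻ y k (suc j) (trans (+-suc k j) eq)) ⟩
  y ^ k * suc y * y           ≡⟨ solve 3 (λ a p y → p :* a :* y := y :* p :* a) refl (suc y) (y ^ k) y ⟩
  y * y ^ k * suc y           ∎
  where
  open ≤-Reasoning
  open +-*-Solver
  step : suc y * j ≤ suc j * y
  step = +-mono-≤ (subst (j ≤_) (suc-injective eq) (m≤n+m j k)) (≤-reflexive (*-comm y j))

-- (1 + 1/y)^M ≤ 2 for y = 2M - 1.
[2M]^M≤2[2M-1]^M : ∀ m → let M = suc m; y = m + M in suc y ^ M ≤ 2 * y ^ M
[2M]^M≤2[2M-1]^M m = *-cancelʳ-≤ _ _ (suc m) (subst (suc y ^ suc m * suc m ≤_)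
  (solve 2 (λ p m → p :* (con 1 :+ (m :+ (con 1 :+ m))) := con 2 :* p :* (con 1 :+ m)) refl (y ^ suc m) m)
  (bernoulli⁻ y (suc m) (suc m) refl))
  where
  open +-*-Solver
  y = m + suc m

fromℕ : (n : ℕ) .{{_ : NonZero n}} → ℝ⁺
fromℕ n = record
  { Below     = λ q → 0ℚᵘ ℚ.< q × q ℚ.< + n ℚ./ 1
  ; positive  = proj₁
  ; inhabited = ½ , ½>0 , <-fromℕ (subst (1 <_) (*-comm 2 n) (+-mono-≤ 1≤n (m≤n⇒m≤n+o 0 1≤n)))
  ; bounded   = + n ℚ./ 1 , proj₂
  ; downward  = λ { p>0 p≤q (_ , q<n) → p>0 , ℚ.≤-<-trans p≤q q<n }
  ; rounded   = λ { (q>0 , q<n) → let r , q<r , r<n = ℚ.<-dense q<n in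
                                  r , q<r , ℚ.<-trans q>0 q<r , r<n }
  }
  where
  1≤n : 1 ≤ n
  1≤n = >-nonZero⁻¹ n

-- The cut of the r > 0 with 2^r < m, which for r = a / b reads 2^a < m^b.
log₂ : (m : ℕ) .{{_ : NonTrivial m}} → ℝ⁺
log₂ m = record
  { Below     = λ r → 0ℚᵘ ℚ.< r × 2 ^ ℤ.∣ ↥ r ∣ < m ^ ↧ₙ r
  ; positive  = proj₁
  ; inhabited = ½ , ½>0 , <-≤-trans (s≤s (s≤s (s≤s z≤n))) (^-monoˡ-≤ 2 2≤m)
  ; bounded   = + m ℚ./ 1 , λ { (h , h′) → bound h h′ }
  ; downward  = λ { h p≤q (h′ , h″) → h , down h h′ p≤q h″ }
  ; rounded   = λ { (h , h′) → up h h′ }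
  }
  where
  open ≤-Reasoning
  2≤m : 2 ≤ m
  2≤m = nonTrivial⇒n>1 m
  bound : ∀ {r} → 0ℚᵘ ℚ.< r → 2 ^ ℤ.∣ ↥ r ∣ < m ^ ↧ₙ r → r ℚ.< + m ℚ./ 1
  bound {mkℚᵘ -[1+ _ ] _} (*<* ())
  bound {mkℚᵘ (+ a) b} _ h = <-fromℕ (subst (_< m * suc b) (sym (*-identityʳ a))
    (exp-cancel-< (begin-strict
      2 ^ a               <⟨ h ⟩
      m ^ suc b           ≤⟨ ^-monoˡ-≤ (suc b) (<⇒≤ (n<2^n m)) ⟩
      (2 ^ m) ^ suc b     ≡⟨ ^-*-assoc 2 m (suc b) ⟩
      2 ^ (m * suc b)     ∎)))
  down : ∀ {p q} → 0ℚᵘ ℚ.< p → 0ℚᵘ ℚ.< q → p ℚ.≤ q →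
         2 ^ ℤ.∣ ↥ q ∣ < m ^ ↧ₙ q → 2 ^ ℤ.∣ ↥ p ∣ < m ^ ↧ₙ p
  down {mkℚᵘ -[1+ _ ] _} (*<* ())
  down {mkℚᵘ (+ _) _} {mkℚᵘ -[1+ _ ] _} _ (*<* ())
  down {mkℚᵘ (+ a) b} {mkℚᵘ (+ c) d} _ _ p≤q h = pow-cancel-< (suc d) (begin-strict
    (2 ^ a) ^ suc d         ≡⟨ ^-*-assoc 2 a (suc d) ⟩
    2 ^ (a * suc d)         ≤⟨ ^-monoʳ-≤ 2 (≤-toℕ p≤q) ⟩
    2 ^ (c * suc b)         ≡⟨ ^-*-assoc 2 c (suc b) ⟨
    (2 ^ c) ^ suc b         <⟨ ^-monoˡ-< (suc b) h ⟩
    (m ^ suc d) ^ suc b     ≡⟨ swap-exp m (suc d) (suc b) ⟩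
    (m ^ suc b) ^ suc d     ∎)
  up : ∀ {r} → 0ℚᵘ ℚ.< r → 2 ^ ℤ.∣ ↥ r ∣ < m ^ ↧ₙ r →
       ∃[ s ] (r ℚ.< s × 0ℚᵘ ℚ.< s × 2 ^ ℤ.∣ ↥ s ∣ < m ^ ↧ₙ s)
  up {mkℚᵘ -[1+ _ ] _} (*<* ())
  up {mkℚᵘ (+ a) b} _ h =
    mkℚᵘ (+ c) (pred d) , r<s , pos-mk (s≤s z≤n)
    , subst (λ k → 2 ^ c < m ^ k) (sym (suc-pred d)) big
    where
    N = 2 ^ a
    instance
      N≢0 : NonZero N
      N≢0 = m^n≢0 2 a
      d≢0 : NonZero (suc b * N * 2)
      d≢0 = m*n≢0 (suc b * N) 2 {{m*n≢0 (suc b) N}}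
    c = suc (a * N * 2)
    d = suc b * N * 2
    root : 2 ^ suc (a * N) ≤ m ^ (suc b * N)
    root = begin
      2 * 2 ^ (a * N)     ≡⟨ cong (2 *_) (^-*-assoc 2 a N) ⟨
      2 * N ^ N           ≤⟨ 2x^x≤[1+x]^x N ⟩
      suc N ^ N           ≤⟨ ^-monoˡ-≤ N h ⟩
      (m ^ suc b) ^ N     ≡⟨ ^-*-assoc m (suc b) N ⟩
      m ^ (suc b * N)     ∎
    big : 2 ^ c < m ^ d
    big = begin-strict
      2 ^ suc (a * N * 2)       <⟨ ^-monoʳ-< 2 (s≤s (s≤s z≤n)) (n<1+n (suc (a * N * 2))) ⟩
      2 ^ (suc (a * N) * 2)     ≡⟨ ^-*-assoc 2 (suc (a * N)) 2 ⟨
      (2 ^ suc (a * N)) ^ 2     ≤⟨ ^-monoˡ-≤ 2 root ⟩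
      (m ^ (suc b * N)) ^ 2     ≡⟨ ^-*-assoc m (suc b * N) 2 ⟩
      m ^ d                     ∎
    r<s : mkℚᵘ (+ a) b ℚ.< mkℚᵘ (+ c) (pred d)
    r<s = <-fromℕ (begin-strict
      a * suc (pred d)            ≡⟨ cong (a *_) (suc-pred d) ⟩
      a * d                       ≡⟨ solve 3 (λ a b n → a :* (b :* n :* con 2) := a :* n :* con 2 :* b) refl a (suc b) N ⟩
      a * N * 2 * suc b           <⟨ *-monoˡ-< (suc b) (n<1+n (a * N * 2)) ⟩
      c * suc b                   ∎)
      where open +-*-Solver

↥-* : ∀ p q → ↥ (p ℚ.* q) ≡ ↥ p ℤ.* ↥ q
↥-* record{} record{} = refl

↧-* : ∀ p q → ↧ₙ (p ℚ.* q) ≡ ↧ₙ p * ↧ₙ q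
↧-* record{} record{} = refl

↥-^ : ∀ s t n → ↥ (mkℚᵘ (+ s) t ^ℚ n) ≡ + (s ^ n)
↥-^ s t zero    = refl
↥-^ s t (suc n) = trans (↥-* (mkℚᵘ (+ s) t) (mkℚᵘ (+ s) t ^ℚ n))
  (trans (cong (+ s ℤ.*_) (↥-^ s t n)) (sym (ℤ.pos-* s (s ^ n))))

↧-^ : ∀ s t n → ↧ₙ (mkℚᵘ (+ s) t ^ℚ n) ≡ suc t ^ n
↧-^ s t zero    = refl
↧-^ s t (suc n) = trans (↧-* (mkℚᵘ (+ s) t) (mkℚᵘ (+ s) t ^ℚ n)) (cong (suc t *_) (↧-^ s t n))

2ℚ : ℚᵘ
2ℚ = + 2 ℚ./ 1

cross : ∀ s t n u v m → ↥ (mkℚᵘ (+ s) t ^ℚ n) ℤ.* ↧ (mkℚᵘ (+ u) v ^ℚ m) ≡ + (s ^ n * suc v ^ m)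
cross s t n u v m = trans (cong₂ ℤ._*_ (↥-^ s t n) (cong +_ (↧-^ u v m))) (sym (ℤ.pos-* (s ^ n) (suc v ^ m)))

*-1^ : ∀ k m → k * 1 ^ m ≡ k
*-1^ k m = trans (cong (k *_) (^-zeroˡ m)) (*-identityʳ k)

pow-toℕ : ∀ {s t n m} → mkℚᵘ (+ s) t ^ℚ n ℚ.≤ 2ℚ ^ℚ m → s ^ n ≤ 2 ^ m * suc t ^ n
pow-toℕ {s} {t} {n} {m} (*≤* h) = subst (_≤ _) (*-1^ (s ^ n) m)
  (ℤ.drop‿+≤+ (subst₂ ℤ._≤_ (cross s t n 2 0 m) (cross 2 0 m s t n) h))

pow-fromℕ : ∀ {s t n m} → s ^ n ≤ 2 ^ m * suc t ^ n → mkℚᵘ (+ s) t ^ℚ n ℚ.≤ 2ℚ ^ℚ m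
pow-fromℕ {s} {t} {n} {m} h =
  *≤* (subst₂ ℤ._≤_ (sym (cross s t n 2 0 m)) (sym (cross 2 0 m s t n))
        (ℤ.+≤+ (subst (_≤ _) (sym (*-1^ (s ^ n) m)) h)))

-- 2^x is the supremum of 2^r over the positive rationals r = a / b < x, and
-- q ≤ 2^r is written q^b ≤ 2^a.
2^_ : ℝ⁺ → ℝ⁺
2^ x = record
  { Below     = Exp
  ; positive  = proj₁
  ; inhabited = 1ℚᵘ , one (proj₂ (inhabited x))
  ; bounded   = bound (bounded x)
  ; downward  = λ { h p≤q (h′ , h″) → h , down h h′ p≤q h″ }
  ; rounded   = λ { (h , r , hr , h′) → up h hr (rounded x hr) h′ }
  }
  where
  open ≤-Reasoning
  Exp : ℚᵘ → Set
  Exp q = 0ℚᵘ ℚ.< q × ∃[ r ] (Below x r × q ^ℚ ↧ₙ r ℚ.≤ (+ 2 ℚ./ 1) ^ℚ ℤ.∣ ↥ r ∣)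
  one : ∀ {r} → Below x r → Exp 1ℚᵘ
  one {r} hr = pos-mk (s≤s z≤n) , r , hr , pow-fromℕ {1} {0} {↧ₙ r} {ℤ.∣ ↥ r ∣} (begin
    1 ^ ↧ₙ r                                ≡⟨ 1*-eq ⟩
    1 * 1 ^ ↧ₙ r                            ≤⟨ *-monoˡ-≤ (1 ^ ↧ₙ r) (m^n>0 2 ℤ.∣ ↥ r ∣) ⟩
    2 ^ ℤ.∣ ↥ r ∣ * 1 ^ ↧ₙ r                ∎)
    where
    1*-eq : 1 ^ ↧ₙ r ≡ 1 * 1 ^ ↧ₙ r
    1*-eq = sym (*-identityˡ (1 ^ ↧ₙ r))
  bound : ∃[ B ] (∀ {q} → Below x q → q ℚ.< B) → ∃[ C ] (∀ {q} → Exp q → q ℚ.< C)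
  bound (B , hB) = + (2 ^ N) ℚ./ 1 , λ { (h , r , hr , h′) → go h (positive x hr) (<N (positive x hr) (hB hr)) h′ }
    where
    N = ℤ.∣ ↥ B ∣
    <N : ∀ {r B} → 0ℚᵘ ℚ.< r → r ℚ.< B → ℤ.∣ ↥ r ∣ < ℤ.∣ ↥ B ∣ * ↧ₙ r
    <N {mkℚᵘ -[1+ _ ] _} (*<* ())
    <N {mkℚᵘ (+ a) b} {mkℚᵘ -[1+ _ ] _} h h′ = contradiction (ℚ.<-trans h h′) λ { (*<* ()) }
    <N {mkℚᵘ (+ a) b} {mkℚᵘ (+ c) d} h h′ = ≤-<-trans (m≤m*n a (suc d)) (<-toℕ h′)
    go : ∀ {q r} → 0ℚᵘ ℚ.< q → 0ℚᵘ ℚ.< r → ℤ.∣ ↥ r ∣ < N * ↧ₙ r →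
         q ^ℚ ↧ₙ r ℚ.≤ 2ℚ ^ℚ ℤ.∣ ↥ r ∣ → q ℚ.< + (2 ^ N) ℚ./ 1
    go {mkℚᵘ -[1+ _ ] _} (*<* ())
    go {mkℚᵘ (+ _) _} {mkℚᵘ -[1+ _ ] _} _ (*<* ())
    go {mkℚᵘ (+ s) t} {mkℚᵘ (+ a) b} _ _ a<Nb h = <-fromℕ (subst (_< 2 ^ N * suc t) (sym (*-identityʳ s))
      (pow-cancel-< (suc b) (begin-strict
        s ^ suc b                             ≤⟨ pow-toℕ {s} {t} {suc b} {a} h ⟩
        2 ^ a * suc t ^ suc b                 <⟨ *-monoˡ-< (suc t ^ suc b) {{m^n≢0 (suc t) (suc b)}} (^-monoʳ-< 2 (s≤s (s≤s z≤n)) a<Nb) ⟩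
        2 ^ (N * suc b) * suc t ^ suc b       ≡⟨ cong (_* suc t ^ suc b) (^-*-assoc 2 N (suc b)) ⟨
        (2 ^ N) ^ suc b * suc t ^ suc b       ≡⟨ ^-distribʳ (2 ^ N) (suc t) (suc b) ⟨
        (2 ^ N * suc t) ^ suc b               ∎)))
  down : ∀ {p q} → 0ℚᵘ ℚ.< p → 0ℚᵘ ℚ.< q → p ℚ.≤ q →
         ∃[ r ] (Below x r × q ^ℚ ↧ₙ r ℚ.≤ 2ℚ ^ℚ ℤ.∣ ↥ r ∣) →
         ∃[ r ] (Below x r × p ^ℚ ↧ₙ r ℚ.≤ 2ℚ ^ℚ ℤ.∣ ↥ r ∣)
  down {mkℚᵘ -[1+ _ ] _} (*<* ())
  down {mkℚᵘ (+ _) _} {mkℚᵘ -[1+ _ ] _} _ (*<* ())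
  down {mkℚᵘ (+ s) t} {mkℚᵘ (+ u) v} _ _ p≤q (r , hr , h) =
    r , hr , pow-fromℕ {s} {t} {n} {k} (*-cancelʳ-≤ _ _ (suc v ^ n) {{m^n≢0 (suc v) n}} (begin
      s ^ n * suc v ^ n                 ≡⟨ ^-distribʳ s (suc v) n ⟨
      (s * suc v) ^ n                   ≤⟨ ^-monoˡ-≤ n (≤-toℕ p≤q) ⟩
      (u * suc t) ^ n                   ≡⟨ ^-distribʳ u (suc t) n ⟩
      u ^ n * suc t ^ n                 ≤⟨ *-monoˡ-≤ (suc t ^ n) (pow-toℕ {u} {v} {n} {k} h) ⟩
      2 ^ k * suc v ^ n * suc t ^ n     ≡⟨ solve 3 (λ a b c → a :* b :* c := a :* c :* b) refl (2 ^ k) (suc v ^ n) (suc t ^ n) ⟩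
      2 ^ k * suc t ^ n * suc v ^ n     ∎))
    where
    open +-*-Solver
    n = ↧ₙ r
    k = ℤ.∣ ↥ r ∣
  up : ∀ {q r} → 0ℚᵘ ℚ.< q → Below x r → ∃[ r′ ] (r ℚ.< r′ × Below x r′) →
       q ^ℚ ↧ₙ r ℚ.≤ 2ℚ ^ℚ ℤ.∣ ↥ r ∣ → ∃[ q′ ] (q ℚ.< q′ × Exp q′)
  up {mkℚᵘ -[1+ _ ] _} (*<* ())
  up {mkℚᵘ (+ _) _} {mkℚᵘ -[1+ _ ] _} _ hr = contradiction (positive x hr) λ { (*<* ()) }
  up {mkℚᵘ (+ _) _} {mkℚᵘ (+ _) _} _ _ (mkℚᵘ -[1+ _ ] _ , _ , hr′) = contradiction (positive x hr′) λ { (*<* ()) }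
  up {mkℚᵘ (+ s) t} {mkℚᵘ (+ a) b} hq hr (mkℚᵘ (+ c) d , r<r′ , hr′) h =
    q′ , <-fromℕ q<q′ , pos-mk 0<q′ , r″
    , downward x (pos-mk 0<cb) (≤-fromℕ (≤-reflexive r″≡)) hr′
    , pow-fromℕ {s * suc y} {pred (suc t * y)} {M} {c * suc b} (subst (λ k → (s * suc y) ^ M ≤ 2 ^ (c * suc b) * k ^ M) (sym (suc-pred (suc t * y))) main)
    where
    open +-*-Solver
    m = d + b * suc d
    M = suc b * suc d
    y = m + suc m
    instance
      y≢0 : NonZero y
      y≢0 = >-nonZero (<-≤-trans (s≤s z≤n) (m≤n+m (suc m) m))
      ty≢0 : NonZero (suc t * y)
      ty≢0 = m*n≢0 (suc t) y
    0<s : 0 < s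
    0<s = subst (0 <_) (*-identityʳ s) (<-toℕ hq)
    q′ = mkℚᵘ (+ (s * suc y)) (pred (suc t * y))
    r″ = mkℚᵘ (+ (c * suc b)) m
    0<cb : 0 < c * suc b
    0<cb = ≤-<-trans z≤n (<-toℕ r<r′)
    0<q′ : 0 < s * suc y
    0<q′ = <-≤-trans 0<s (m≤m*n s (suc y))
    q<q′ : s * suc (pred (suc t * y)) < s * suc y * suc t
    q<q′ = begin-strict
      s * suc (pred (suc t * y))    ≡⟨ cong (s *_) (suc-pred (suc t * y)) ⟩
      s * (suc t * y)               ≡⟨ solve 3 (λ s t y → s :* (t :* y) := s :* t :* y) refl s (suc t) y ⟩
      s * suc t * y                 <⟨ *-monoʳ-< (s * suc t) {{m*n≢0 s (suc t) {{>-nonZero 0<s}}}} (n<1+n y) ⟩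
      s * suc t * suc y             ≡⟨ solve 3 (λ s t y → s :* t :* y := s :* y :* t) refl s (suc t) (suc y) ⟩
      s * suc y * suc t             ∎
    r″≡ : c * suc b * suc d ≡ c * suc m
    r″≡ = *-assoc c (suc b) (suc d)
    main : (s * suc y) ^ M ≤ 2 ^ (c * suc b) * (suc t * y) ^ M
    main = begin
      (s * suc y) ^ M                                         ≡⟨ ^-distribʳ s (suc y) M ⟩
      s ^ M * suc y ^ M                                       ≡⟨ cong (_* suc y ^ M) (^-*-assoc s (suc b) (suc d)) ⟨
      (s ^ suc b) ^ suc d * suc y ^ M                         ≤⟨ *-mono-≤ (^-monoˡ-≤ (suc d) (pow-toℕ {s} {t} {suc b} {a} h)) ([2M]^M≤2[2M-1]^M m) ⟩
      (2 ^ a * suc t ^ suc b) ^ suc d * (2 * y ^ M)           ≡⟨ cong (_* (2 * y ^ M)) (^-distribʳ (2 ^ a) (suc t ^ suc b) (suc d)) ⟩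
      (2 ^ a) ^ suc d * (suc t ^ suc b) ^ suc d * (2 * y ^ M) ≡⟨ cong₂ (λ k l → k * l * (2 * y ^ M)) (^-*-assoc 2 a (suc d)) (^-*-assoc (suc t) (suc b) (suc d)) ⟩
      2 ^ (a * suc d) * suc t ^ M * (2 * y ^ M)               ≡⟨ solve 3 (λ k l n → k :* l :* (con 2 :* n) := con 2 :* k :* (l :* n)) refl (2 ^ (a * suc d)) (suc t ^ M) (y ^ M) ⟩
      2 ^ suc (a * suc d) * (suc t ^ M * y ^ M)               ≤⟨ *-monoˡ-≤ (suc t ^ M * y ^ M) (^-monoʳ-≤ 2 (<-toℕ r<r′)) ⟩
      2 ^ (c * suc b) * (suc t ^ M * y ^ M)                   ≡⟨ cong (_*_ (2 ^ (c * suc b))) (^-distribʳ (suc t) y M) ⟨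
      2 ^ (c * suc b) * (suc t * y) ^ M                       ∎

{-# OPTIONS --safe #-}

-- A quasigroup is determined by its values on {0,1,2}ⁿ, since along each line
-- the fourth value is the one not taken by the other three; hence the bound.
-- The equality of reals is assembled from n log₂ m = log₂ mⁿ,
-- log₂ m + 1 = log₂ (2m), 2^(log₂ m) = m and K = log₂ 2ᴷ.

module Submission where

open import Defs
open import Data.Fin using (Fin; zero; suc; inject₁; finToFun; funToFin)
open import Data.Fin.Properties using (injective⇒≤; finToFun-funToFin)
import Data.Fin as Fin
import Data.Fin.Properties as Fin
open import Data.Fin.Relation.Unary.Top using (view; ‵fromℕ; ‵inject₁)
open import Data.Integer using (+_; -[1+_])
import Data.Integer as ℤ
import Data.Integer.Properties as ℤ
open import Data.Nat
open import Data.Nat.Properties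
open import Data.Nat.Solver using (module +-*-Solver)
open import Data.Product using (∃-syntax; _×_; _,_; proj₁; proj₂)
open import Data.Rational.Unnormalised using (ℚᵘ; mkℚᵘ; 0ℚᵘ; *<*)
import Data.Rational.Unnormalised as ℚ
import Data.Rational.Unnormalised.Properties as ℚ
open import Data.Vec using (Vec; []; _∷_; lookup; tabulate; map)
open import Data.Vec.Properties using (tabulate∘lookup; tabulate-cong)
open import Function using (_∘_; Bijection; Injective)
open import Relation.Binary using (Setoid)
open import Relation.Binary.PropositionalEquality
import Relation.Binary.Reasoning.Setoid as SetoidReasoning
open import Relation.Nullary using (yes; no; contradiction)

open import Algebra.Definitions.RawSemiring ℚ.+-*-rawSemiring using ()
  renaming (_^_ to _^ℚ_)

open ℝ⁺

-- Quasigroups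

-- Pigeonhole: if the values at the top element differed, the top value of `f` would also differ
-- from every other value of `g`, since `g` agrees with the injective `f` there. Adjoining it to the
-- values of `g` would inject a set of size n + 2 into one of size n + 1.
injective-determined-at-top :
  ∀ {n} {f g : Fin (suc n) → Fin (suc n)} →
  Injective _≡_ _≡_ f → Injective _≡_ _≡_ g →
  (∀ i → f (inject₁ i) ≡ g (inject₁ i)) → f ≗ g
injective-determined-at-top {n} {f} {g} f-inj g-inj eq i with view i
... | ‵inject₁ j = eq j
... | ‵fromℕ with f (Fin.fromℕ n) Fin.≟ g (Fin.fromℕ n)
...   | yes p = p
...   | no f≢g = contradiction (injective⇒≤ h-inj) (n≮n (suc n))
  where
  h : Fin (suc (suc n)) → Fin (suc n)
  h zero    = f (Fin.fromℕ n)
  h (suc j) = g j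
  fresh : ∀ j → f (Fin.fromℕ n) ≢ g j
  fresh j p with view j
  ... | ‵fromℕ     = f≢g p
  ... | ‵inject₁ k = Fin.fromℕ≢inject₁ (f-inj (trans p (sym (eq k))))
  h-inj : Injective _≡_ _≡_ h
  h-inj {zero}  {zero}  _ = refl
  h-inj {zero}  {suc j} p = contradiction p (fresh j)
  h-inj {suc j} {zero}  p = contradiction (sym p) (fresh j)
  h-inj {suc j} {suc k} p = cong suc (g-inj p)

line-injective : ∀ {n} {q : Vec A (suc n) → A} → IsQuasigroup q →
                 ∀ v → Injective _≡_ _≡_ (λ a → q (a ∷ v))
line-injective qg v {a} {b} eq with a Fin.≟ b
... | yes p  = p
... | no a≢b = contradiction eq (qg (a ∷ v) (b ∷ v)
  (zero , a≢b , λ { {zero} _ → refl ; {suc _} ne → contradiction refl ne }))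

slice-isQuasigroup : ∀ {n} {q : Vec A (suc n) → A} → IsQuasigroup q →
                     ∀ a → IsQuasigroup (q ∘ (a ∷_))
slice-isQuasigroup qg a c c′ (i , ne , unique) = qg (a ∷ c) (a ∷ c′)
  (suc i , ne , λ { {zero} ne′ → contradiction refl ne′ ; {suc _} ne′ → cong suc (unique ne′) })

-- Induction on the number of coordinates. For each first coordinate `inject₁ b` the slices agree
-- everywhere by the induction hypothesis; so along the line through `v` in the first direction the
-- two injective maps agree off the top element, hence also at it.
quasigroup-determined :
  ∀ n {q q′ : Vec A n → A} → IsQuasigroup q → IsQuasigroup q′ →
  (∀ u → q (map inject₁ u) ≡ q′ (map inject₁ u)) → q ≗ q′
quasigroup-determined zero    _  _   eq []      = eq []
quasigroup-determined (suc n) qg qg′ eq (a ∷ v) =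
  injective-determined-at-top (line-injective qg v) (line-injective qg′ v)
    (λ b → quasigroup-determined n (slice-isQuasigroup qg (inject₁ b))
             (slice-isQuasigroup qg′ (inject₁ b)) (λ u → eq (b ∷ u)) v)
    a

-- An index below `3 ^ n` is read as `n` ternary digits, a point of {0,1,2}ⁿ; the table of values at
-- these points is then packed into one number.
restrictionCode : ∀ n → (Vec A n → A) → Fin (4 ^ (3 ^ n))
restrictionCode n q = funToFin {3 ^ n} (λ i → q (map inject₁ (tabulate (finToFun {3} {n} i))))

restrictionCode-injective :
  ∀ n {q q′ : Vec A n → A} → IsQuasigroup q → IsQuasigroup q′ →
  restrictionCode n q ≡ restrictionCode n q′ → q ≗ q′
restrictionCode-injective n {q} {q′} qg qg′ eq = quasigroup-determined n qg qg′ λ u →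
  -- Decoding the index `i` gives back `u`, so entry `i` of either table is the value at `u`.
  let i = funToFin (lookup u)
      u≡ = trans (tabulate-cong (finToFun-funToFin (lookup u))) (tabulate∘lookup u)
  in subst (λ w → q (map inject₁ w) ≡ q′ (map inject₁ w)) u≡
       (trans (sym (finToFun-funToFin (λ j → q (map inject₁ (tabulate (finToFun j)))) i))
         (trans (cong (λ t → finToFun t i) eq)
           (finToFun-funToFin (λ j → q′ (map inject₁ (tabulate (finToFun j)))) i)))

Q≤4^3^n : ∀ n → Q n ≤ 4 ^ (3 ^ n)
Q≤4^3^n n = injective⇒≤ {f = restrictionCode n ∘ proj₁ ∘ to}
  λ {i} {j} eq → injective (restrictionCode-injective n (proj₂ (to i)) (proj₂ (to j)) eq)
  where open Bijection (Q-counts n)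

-- Positive rationals as fractions of natural numbers

-- Matching on this view exposes a natural numerator and denominator, so that `<-toℕ` and its
-- companions turn comparisons of rationals into inequalities of naturals.
data Fraction : ℚᵘ → Set where
  frac : ∀ a b → Fraction (mkℚᵘ (+ suc a) b)

fraction : ∀ {q} → 0ℚᵘ ℚ.< q → Fraction q
fraction {mkℚᵘ (+ zero) _}  (*<* (ℤ.+<+ ()))
fraction {mkℚᵘ (+ suc a) b} _ = frac a b
fraction {mkℚᵘ -[1+ _ ] _}  (*<* ())

-- `mkℚᵘ` stores the predecessor of the denominator, and `d + b * suc d` is the predecessor of
-- `suc b * suc d`.
mk-+ : ∀ a b c d → mkℚᵘ (+ a) b ℚ.+ mkℚᵘ (+ c) d ≡
                   mkℚᵘ (+ (a * suc d + c * suc b)) (d + b * suc d)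
mk-+ a b c d = cong (λ k → mkℚᵘ k (d + b * suc d))
  (sym (cong₂ ℤ._+_ (ℤ.pos-* a (suc d)) (ℤ.pos-* c (suc b))))

mk-* : ∀ a b c d → mkℚᵘ (+ a) b ℚ.* mkℚᵘ (+ c) d ≡ mkℚᵘ (+ (a * c)) (d + b * suc d)
mk-* a b c d = cong (λ k → mkℚᵘ k (d + b * suc d)) (sym (ℤ.pos-* a c))

-- Equality of reals

ℝ⁺-setoid : Setoid _ _
ℝ⁺-setoid = record
  { Carrier       = ℝ⁺
  ; _≈_           = _≈_
  ; isEquivalence = record
    { refl  = λ _ → (λ h → h) , (λ h → h)
    ; sym   = λ xy q → proj₂ (xy q) , proj₁ (xy q)
    ; trans = λ xy yz q → proj₁ (yz q) ∘ proj₁ (xy q) , proj₂ (xy q) ∘ proj₂ (yz q)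
    }
  }

+ℝ-congʳ : ∀ x y z → x ≈ y → x +ℝ z ≈ y +ℝ z
+ℝ-congʳ x y z xy q =
  (λ { (q>0 , r , s , hr , rest) → q>0 , r , s , proj₁ (xy r) hr , rest }) ,
  (λ { (q>0 , r , s , hr , rest) → q>0 , r , s , proj₂ (xy r) hr , rest })

2^-cong : ∀ x y → x ≈ y → 2^ x ≈ 2^ y
2^-cong x y xy q =
  (λ { (q>0 , r , hr , h) → q>0 , r , proj₁ (xy r) hr , h }) ,
  (λ { (q>0 , r , hr , h) → q>0 , r , proj₂ (xy r) hr , h })

fromℕ-cong : ∀ {m n} .{{_ : NonZero m}} .{{_ : NonZero n}} → m ≡ n → fromℕ m ≈ fromℕ n
fromℕ-cong refl q = (λ h → h) , (λ h → h)

-- Logarithms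

-- For q = a / b both cuts say a < n b, because 2^a < (2^n)^b = 2^(n b) is a comparison of
-- exponents.
fromℕ≈log₂-2^ : ∀ n .{{_ : NonZero n}} .{{_ : NonTrivial (2 ^ n)}} → fromℕ n ≈ log₂ (2 ^ n)
fromℕ≈log₂-2^ n q =
  (λ { (q>0 , q<n) → q>0 , to (fraction q>0) q<n }) ,
  (λ { (q>0 , h) → q>0 , from (fraction q>0) h })
  where
  to : ∀ {q} → Fraction q → q ℚ.< + n ℚ./ 1 → 2 ^ ℤ.∣ ℚ.↥ q ∣ < (2 ^ n) ^ ℚ.↧ₙ q
  to (frac a b) q<n = subst (2 ^ suc a <_) (sym (^-*-assoc 2 n (suc b)))
    (^-monoʳ-< 2 (n<1+n 1) (subst (_< n * suc b) (*-identityʳ (suc a)) (<-toℕ q<n)))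
  from : ∀ {q} → Fraction q → 2 ^ ℤ.∣ ℚ.↥ q ∣ < (2 ^ n) ^ ℚ.↧ₙ q → q ℚ.< + n ℚ./ 1
  from (frac a b) h = <-fromℕ (subst (_< n * suc b) (sym (*-identityʳ (suc a)))
    (exp-cancel-< (subst (2 ^ suc a <_) (^-*-assoc 2 n (suc b)) h)))

-- The exponent is written a + 1 since cuts contain only positive rationals.
dyadic-bracket : ∀ {m} → 2 < m → ∃[ a ] (2 ^ suc a < m × m ≤ 2 ^ suc (suc a))
dyadic-bracket {m} 2<m = search m (≤-trans (<⇒≤ (n<2^n m)) (^-monoʳ-≤ 2 (n≤1+n m)))
  where
  search : ∀ k → m ≤ 2 ^ suc k → ∃[ a ] (2 ^ suc a < m × m ≤ 2 ^ suc (suc a))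
  search zero    m≤2 = contradiction 2<m (≤⇒≯ m≤2)
  search (suc k) m≤ with 2 ^ suc k <? m
  ... | yes p = k , p , m≤
  ... | no ¬p = search k (≮⇒≥ ¬p)

-- Bernoulli gives (1 + 1/x)^(2x) ≥ 3. The exponent 2x, rather than x, is at least 2 even for x = 1,
-- which `2^log₂` uses to get `2 < m ^ b`.
2x^2x≤[1+x]^2x : ∀ x .{{_ : NonZero x}} → 2 * x ^ (x * 2) ≤ suc x ^ (x * 2)
2x^2x≤[1+x]^2x x = *-cancelʳ-≤ _ _ x (begin
  2 * x ^ (x * 2) * x             ≡⟨ solve 2 (λ x p → con 2 :* p :* x := p :* (x :* con 2)) refl x (x ^ (x * 2)) ⟩
  x ^ (x * 2) * (x * 2)           ≤⟨ *-monoʳ-≤ (x ^ (x * 2)) (m≤n+m (x * 2) x) ⟩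
  x ^ (x * 2) * (x + x * 2)       ≤⟨ bernoulli x (x * 2) ⟩
  suc x ^ (x * 2) * x             ∎)
  where
  open ≤-Reasoning
  open +-*-Solver

-- Above q < m a rational exponent r < log₂ m with q ≤ 2^r must be found. Rounding log₂ (m^b) down
-- to an integer loses at most a factor 2 in m^b, and b is taken so large that 2 q^b ≤ m^b makes up
-- for it.
2^log₂ : ∀ m .{{_ : NonTrivial m}} .{{_ : NonZero m}} → 2^ (log₂ m) ≈ fromℕ m
2^log₂ m q =
  (λ { (q>0 , r , (r>0 , h) , h′) → q>0 , to (fraction q>0) (fraction r>0) h h′ }) ,
  (λ { (q>0 , q<m) → from (fraction q>0) q<m })
  where
  open ≤-Reasoning
  to : ∀ {q r} → Fraction q → Fraction r → 2 ^ ℤ.∣ ℚ.↥ r ∣ < m ^ ℚ.↧ₙ r →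
       q ^ℚ ℚ.↧ₙ r ℚ.≤ 2ℚ ^ℚ ℤ.∣ ℚ.↥ r ∣ → q ℚ.< + m ℚ./ 1
  to (frac s t) (frac a b) h h′ = <-fromℕ (subst (_< m * suc t) (sym (*-identityʳ (suc s)))
    (pow-cancel-< (suc b) (begin-strict
      suc s ^ suc b                 ≤⟨ pow-toℕ {suc s} {t} {suc b} {suc a} h′ ⟩
      2 ^ suc a * suc t ^ suc b     <⟨ *-monoˡ-< (suc t ^ suc b) {{m^n≢0 (suc t) (suc b)}} h ⟩
      m ^ suc b * suc t ^ suc b     ≡⟨ ^-distribʳ m (suc t) (suc b) ⟨
      (m * suc t) ^ suc b           ∎)))
  from : ∀ {q} → Fraction q → q ℚ.< + m ℚ./ 1 → Below (2^ (log₂ m)) q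
  from (frac s t) q<m =
    -- The exponent is r = (a + 1) / b; `suc (s * 2)` is the predecessor of `b`.
    pos-mk (s≤s z≤n) , mkℚᵘ (+ suc a) (suc (s * 2)) , (pos-mk (s≤s z≤n) , 2^a<m^b)
    , pow-fromℕ {suc s} {t} {b} {suc a} (*-cancelˡ-≤ 2 (begin
        2 * suc s ^ b                         ≤⟨ 2x^2x≤[1+x]^2x (suc s) ⟩
        suc (suc s) ^ b                       ≤⟨ ^-monoˡ-≤ b s<mt ⟩
        (m * suc t) ^ b                       ≡⟨ ^-distribʳ m (suc t) b ⟩
        m ^ b * suc t ^ b                     ≤⟨ *-monoˡ-≤ (suc t ^ b) m^b≤ ⟩
        2 * 2 ^ suc a * suc t ^ b             ≡⟨ *-assoc 2 (2 ^ suc a) (suc t ^ b) ⟩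
        2 * (2 ^ suc a * suc t ^ b)           ∎))
    where
    b = suc s * 2
    s<mt : suc s < m * suc t
    s<mt = subst (_< m * suc t) (*-identityʳ (suc s)) (<-toℕ q<m)
    2<m^b : 2 < m ^ b
    2<m^b = begin-strict
      2         <⟨ s≤s (s≤s (s≤s z≤n)) ⟩
      2 ^ 2     ≤⟨ ^-monoʳ-≤ 2 {2} {b} (s≤s (s≤s z≤n)) ⟩
      2 ^ b     ≤⟨ ^-monoˡ-≤ b (nonTrivial⇒n>1 m) ⟩
      m ^ b     ∎
    bracket = dyadic-bracket 2<m^b
    a = proj₁ bracket
    2^a<m^b = proj₁ (proj₂ bracket)
    m^b≤ = proj₂ (proj₂ bracket)

-- From left to right, raising to the power `B * D` clears the denominators of r and s. From right
-- to left, q must be bounded by a product whose second factor is strictly below `n`, so room is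
-- first made by passing to some q′ > q in the same cut.
log₂-*ℝ : ∀ m n .{{_ : NonTrivial m}} .{{_ : NonZero n}} .{{_ : NonTrivial (m ^ n)}} →
          log₂ m *ℝ fromℕ n ≈ log₂ (m ^ n)
log₂-*ℝ m n@(suc k) q =
  (λ { (q>0 , r , s , (r>0 , h) , (s>0 , s<n) , q≤rs) →
       q>0 , to (fraction q>0) (fraction r>0) (fraction s>0) h s<n q≤rs }) ,
  (λ { (q>0 , h) → let q′ , q<q′ , q′>0 , h′ = rounded (log₂ (m ^ n)) {q} (q>0 , h) in
       q>0 , from (fraction q>0) (fraction q′>0) q<q′ h′ })
  where
  open ≤-Reasoning
  open +-*-Solver
  instance
    m≢0 : NonZero m
    m≢0 = nonTrivial⇒nonZero m
  to : ∀ {q r s} → Fraction q → Fraction r → Fraction s →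
       2 ^ ℤ.∣ ℚ.↥ r ∣ < m ^ ℚ.↧ₙ r → s ℚ.< + n ℚ./ 1 → q ℚ.≤ r ℚ.* s →
       2 ^ ℤ.∣ ℚ.↥ q ∣ < (m ^ n) ^ ℚ.↧ₙ q
  to (frac e f) (frac a b) (frac c d) h s<n q≤rs = pow-cancel-< (B * D) (begin-strict
    (2 ^ E) ^ (B * D)             ≡⟨ ^-*-assoc 2 E (B * D) ⟩
    2 ^ (E * (B * D))             ≤⟨ ^-monoʳ-≤ 2 (≤-toℕ (subst (mkℚᵘ (+ E) f ℚ.≤_) (mk-* (suc a) b C d) q≤rs)) ⟩
    2 ^ (suc a * C * F)           ≡⟨ cong (2 ^_) (*-assoc (suc a) C F) ⟩
    2 ^ (suc a * (C * F))         ≡⟨ ^-*-assoc 2 (suc a) (C * F) ⟨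
    (2 ^ suc a) ^ (C * F)         <⟨ ^-monoˡ-< (C * F) h ⟩
    (m ^ B) ^ (C * F)             ≡⟨ ^-*-assoc m B (C * F) ⟩
    m ^ (B * (C * F))             ≤⟨ ^-monoʳ-≤ m (*-monoʳ-≤ B (*-monoˡ-≤ F (<⇒≤ c<nd))) ⟩
    m ^ (B * (n * D * F))         ≡⟨ cong (m ^_) (solve 4 (λ b n d f → b :* (n :* d :* f) := n :* f :* (b :* d)) refl B n D F) ⟩
    m ^ (n * F * (B * D))         ≡⟨ ^-*-assoc m (n * F) (B * D) ⟨
    (m ^ (n * F)) ^ (B * D)       ≡⟨ cong (_^ (B * D)) (^-*-assoc m n F) ⟨
    ((m ^ n) ^ F) ^ (B * D)       ∎)
    where
    B = suc b
    C = suc c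
    D = suc d
    E = suc e
    F = suc f
    c<nd : C < n * D
    c<nd = subst (_< n * D) (*-identityʳ C) (<-toℕ s<n)
  -- r = q′ / n and s = n q / q′.
  from : ∀ {q q′} → Fraction q → Fraction q′ → q ℚ.< q′ →
         2 ^ ℤ.∣ ℚ.↥ q′ ∣ < (m ^ n) ^ ℚ.↧ₙ q′ →
         ∃[ r ] ∃[ s ] (Below (log₂ m) r × Below (fromℕ n) s × q ℚ.≤ r ℚ.* s)
  from (frac e f) (frac e′ f′) q<q′ h =
    mkℚᵘ (+ E′) (f′ + k * F′) , mkℚᵘ (+ (E * (n * F′))) (e′ + f * E′)
    , (pos-mk (s≤s z≤n) , subst (2 ^ E′ <_) (^-*-assoc m n F′) h)
    , (pos-mk (s≤s z≤n) , <-fromℕ (begin-strict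
        E * (n * F′) * 1        ≡⟨ solve 3 (λ e n f → e :* (n :* f) :* con 1 := n :* (e :* f)) refl E n F′ ⟩
        n * (E * F′)            <⟨ *-monoʳ-< n (<-toℕ q<q′) ⟩
        n * (E′ * F)            ≡⟨ cong (n *_) (*-comm E′ F) ⟩
        n * (F * E′)            ∎))
    , subst (mkℚᵘ (+ E) f ℚ.≤_) (sym (mk-* E′ (f′ + k * F′) (E * (n * F′)) (e′ + f * E′)))
        (≤-fromℕ (≤-reflexive
          (solve 5 (λ e f e′ f′ n → e :* (n :* f′ :* (f :* e′)) := e′ :* (e :* (n :* f′)) :* f)
            refl E F E′ F′ n)))
    where
    E = suc e
    F = suc f
    E′ = suc e′
    F′ = suc f′

-- The argument follows the product case: 2^q′ < 2m means 2^(q′ - 1) < m, and the gap between q and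
-- q′ lets the second summand stay strictly below 1. Cuts contain only positive rationals, so q′ ≤ 1
-- is treated apart.
log₂-+1 : ∀ m .{{_ : NonTrivial m}} .{{_ : NonTrivial (2 * m)}} →
          log₂ m +ℝ fromℕ 1 ≈ log₂ (2 * m)
log₂-+1 m q =
  (λ { (q>0 , r , s , (r>0 , h) , (s>0 , s<1) , q≤r+s) →
       q>0 , to (fraction q>0) (fraction r>0) (fraction s>0) h s<1 q≤r+s }) ,
  (λ { (q>0 , h) → let q′ , q<q′ , q′>0 , h′ = rounded (log₂ (2 * m)) {q} (q>0 , h) in
       q>0 , from (fraction q>0) (fraction q′>0) q<q′ h′ })
  where
  open ≤-Reasoning
  open +-*-Solver
  to : ∀ {q r s} → Fraction q → Fraction r → Fraction s →
       2 ^ ℤ.∣ ℚ.↥ r ∣ < m ^ ℚ.↧ₙ r → s ℚ.< + 1 ℚ./ 1 → q ℚ.≤ r ℚ.+ s →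
       2 ^ ℤ.∣ ℚ.↥ q ∣ < (2 * m) ^ ℚ.↧ₙ q
  to (frac e f) (frac a b) (frac c d) h s<1 q≤r+s = pow-cancel-< (B * D) (begin-strict
    (2 ^ E) ^ (B * D)                         ≡⟨ ^-*-assoc 2 E (B * D) ⟩
    2 ^ (E * (B * D))                         ≤⟨ ^-monoʳ-≤ 2 (≤-toℕ (subst (mkℚᵘ (+ E) f ℚ.≤_) (mk-+ (suc a) b C d) q≤r+s)) ⟩
    2 ^ ((suc a * D + C * B) * F)             ≡⟨ cong (2 ^_) (solve 5 (λ a b c d f → (a :* d :+ c :* b) :* f := c :* b :* f :+ a :* (d :* f)) refl (suc a) B C D F) ⟩
    2 ^ (C * B * F + suc a * (D * F))         ≡⟨ ^-distribˡ-+-* 2 (C * B * F) (suc a * (D * F)) ⟩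
    2 ^ (C * B * F) * 2 ^ (suc a * (D * F))   ≡⟨ cong (2 ^ (C * B * F) *_) (^-*-assoc 2 (suc a) (D * F)) ⟨
    2 ^ (C * B * F) * (2 ^ suc a) ^ (D * F)   <⟨ *-monoʳ-< (2 ^ (C * B * F)) {{m^n≢0 2 (C * B * F)}} (^-monoˡ-< (D * F) h) ⟩
    2 ^ (C * B * F) * (m ^ B) ^ (D * F)       ≤⟨ *-monoˡ-≤ ((m ^ B) ^ (D * F)) (^-monoʳ-≤ 2 (*-monoˡ-≤ F (*-monoˡ-≤ B c≤d))) ⟩
    2 ^ (D * B * F) * (m ^ B) ^ (D * F)       ≡⟨ cong₂ _*_ (cong (2 ^_) (solve 3 (λ b d f → d :* b :* f := f :* (b :* d)) refl B D F))
                                                   (trans (^-*-assoc m B (D * F)) (cong (m ^_) (solve 3 (λ b d f → b :* (d :* f) := f :* (b :* d)) refl B D F))) ⟩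
    2 ^ (F * (B * D)) * m ^ (F * (B * D))     ≡⟨ ^-distribʳ 2 m (F * (B * D)) ⟨
    (2 * m) ^ (F * (B * D))                   ≡⟨ ^-*-assoc (2 * m) F (B * D) ⟨
    ((2 * m) ^ F) ^ (B * D)                   ∎)
    where
    B = suc b
    C = suc c
    D = suc d
    E = suc e
    F = suc f
    c≤d : C ≤ D
    c≤d = subst₂ _≤_ (*-identityʳ C) (*-identityˡ D) (<⇒≤ (<-toℕ s<1))
  from : ∀ {q q′} → Fraction q → Fraction q′ → q ℚ.< q′ →
         2 ^ ℤ.∣ ℚ.↥ q′ ∣ < (2 * m) ^ ℚ.↧ₙ q′ →
         ∃[ r ] ∃[ s ] (Below (log₂ m) r × Below (fromℕ 1) s × q ℚ.≤ r ℚ.+ s)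
  from {q} {q′} (frac e f) (frac e′ f′) q<q′ h with suc f′ <? suc e′
  -- q′ ≤ 1: s = q, and any r will do.
  ... | no ¬p = r , q , hr , (q>0 , ℚ.<-≤-trans q<q′ q′≤1)
    , subst (ℚ._≤ r ℚ.+ q) (ℚ.+-identityˡ-≡ q) (ℚ.+-monoˡ-≤ q (ℚ.<⇒≤ (positive (log₂ m) {r} hr)))
    where
    r = proj₁ (inhabited (log₂ m))
    hr = proj₂ (inhabited (log₂ m))
    q>0 : 0ℚᵘ ℚ.< q
    q>0 = pos-mk (s≤s z≤n)
    q′≤1 : q′ ℚ.≤ + 1 ℚ./ 1
    q′≤1 = ≤-fromℕ (subst₂ _≤_ (sym (*-identityʳ (suc e′))) (sym (*-identityˡ (suc f′))) (≮⇒≥ ¬p))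
  -- q′ > 1: r = q′ - 1 and s = 1 - 1/N, where 1/N ≤ q′ - q.
  ... | yes p = mkℚᵘ (+ g) f′ , mkℚᵘ (+ N-1) N-1
    , (pos-mk (m<n⇒0<n∸m p) , *-cancelˡ-< (2 ^ F′) (2 ^ g) (m ^ F′) (begin-strict
        2 ^ F′ * 2 ^ g          ≡⟨ ^-distribˡ-+-* 2 F′ g ⟨
        2 ^ (F′ + g)            ≡⟨ cong (2 ^_) F′+g≡E′ ⟩
        2 ^ E′                  <⟨ h ⟩
        (2 * m) ^ F′            ≡⟨ ^-distribʳ 2 m F′ ⟩
        2 ^ F′ * m ^ F′         ∎))
    , (pos-mk (s≤s z≤n) , <-fromℕ (subst₂ _<_ (sym (*-identityʳ N-1)) (sym (*-identityˡ N)) (n<1+n N-1)))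
    , subst (mkℚᵘ (+ E) f ℚ.≤_) (sym (mk-+ g f′ N-1 N-1)) (≤-fromℕ main)
    where
    E = suc e
    F = suc f
    E′ = suc e′
    F′ = suc f′
    g = E′ ∸ F′
    -- This is 2 F F′, in a form whose predecessor is visibly a successor. The gap q′ - q is at
    -- least 1 / (F F′), and the factor 2 keeps 1 - 1/N positive when F = F′ = 1.
    N = suc (suc (f′ + f * F′) + (f′ + f * F′))
    N-1 = suc (f′ + f * F′) + (f′ + f * F′)
    F′+g≡E′ : F′ + g ≡ E′
    F′+g≡E′ = m+[n∸m]≡n (<⇒≤ p)
    N≡ : N ≡ 2 * (F * F′)
    N≡ = solve 1 (λ x → con 1 :+ (con 1 :+ x :+ x) := con 2 :* (con 1 :+ x)) refl (f′ + f * F′)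
    FF′≤N : F * F′ ≤ N
    FF′≤N = subst (F * F′ ≤_) (sym N≡) (m≤m+n (F * F′) _)
    main : E * (F′ * N) ≤ (g * N + N-1 * F′) * F
    -- Adding `F * F′` to both sides replaces subtracting 1/N. It is paid for by the integer gap
    -- `suc (E * F′) ≤ E′ * F`, multiplied by `N`.
    main = +-cancelʳ-≤ (F * F′) _ _ (begin
      E * (F′ * N) + F * F′              ≤⟨ +-monoʳ-≤ (E * (F′ * N)) FF′≤N ⟩
      E * (F′ * N) + N                   ≡⟨ solve 3 (λ e f n → e :* (f :* n) :+ n := (con 1 :+ e :* f) :* n) refl E F′ N ⟩
      suc (E * F′) * N                   ≤⟨ *-monoˡ-≤ N (<-toℕ q<q′) ⟩
      E′ * F * N                         ≡⟨ cong (λ k → k * F * N) (sym F′+g≡E′) ⟩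
      (F′ + g) * F * N                   ≡⟨ solve 4 (λ f f′ g n → (f′ :+ g) :* f :* (con 1 :+ n) := (g :* (con 1 :+ n) :+ n :* f′) :* f :+ f :* f′) refl F F′ g N-1 ⟩
      (g * N + N-1 * F′) * F + F * F′    ∎)

-- The number 4^(3^n) as a double exponential

^-nonTrivial : ∀ m n .{{_ : NonTrivial m}} .{{_ : NonZero n}} → NonTrivial (m ^ n)
^-nonTrivial m n = n>1⇒nonTrivial (begin-strict
  1         <⟨ nonTrivial⇒n>1 m ⟩
  m         ≡⟨ *-identityʳ m ⟨
  m ^ 1     ≤⟨ ^-monoʳ-≤ m {{nonTrivial⇒nonZero m}} (>-nonZero⁻¹ n) ⟩
  m ^ n     ∎)
  where open ≤-Reasoning

mainTheorem6 : ∀ (n : ℕ) .{{_ : NonZero n}} →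
    (Q n ≤ 4 ^ (3 ^ n)) ×
    (fromℕ (4 ^ (3 ^ n)) {{m^n≢0 4 (3 ^ n)}} ≈ 2^ (2^ (log₂ 3 *ℝ fromℕ n +ℝ fromℕ 1)))
mainTheorem6 n = Q≤4^3^n n , (begin
    fromℕ (4 ^ (3 ^ n))     ≈⟨ fromℕ-cong (^-*-assoc 2 2 (3 ^ n)) ⟩
    fromℕ (2 ^ K)           ≈⟨ 2^log₂ (2 ^ K) ⟨
    2^ (log₂ (2 ^ K))       ≈⟨ 2^-cong (fromℕ K) (log₂ (2 ^ K)) (fromℕ≈log₂-2^ K) ⟨
    2^ (fromℕ K)            ≈⟨ 2^-cong (2^ (log₂ K)) (fromℕ K) (2^log₂ K) ⟨
    2^ (2^ (log₂ K))        ≈⟨ 2^-cong (2^ x) (2^ (log₂ K)) (2^-cong x (log₂ K) x≈log₂K) ⟨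
    2^ (2^ x)               ∎)
  where
  open SetoidReasoning ℝ⁺-setoid
  -- The exponent in 4^(3^n) = 2^K; its factor 2 becomes the summand 1 of `x`.
  K = 2 * 3 ^ n
  x = log₂ 3 *ℝ fromℕ n +ℝ fromℕ 1
  instance
    3ⁿ-nonTrivial : NonTrivial (3 ^ n)
    3ⁿ-nonTrivial = ^-nonTrivial 3 n
    K≢0 : NonZero K
    K≢0 = m*n≢0 2 (3 ^ n) {{_}} {{m^n≢0 3 n}}
    K-nonTrivial : NonTrivial K
    K-nonTrivial = n>1⇒nonTrivial (*-monoʳ-≤ 2 (m^n>0 3 n))
    2ᴷ-nonTrivial : NonTrivial (2 ^ K)
    2ᴷ-nonTrivial = ^-nonTrivial 2 K
    2ᴷ≢0 : NonZero (2 ^ K)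
    2ᴷ≢0 = m^n≢0 2 K
    4^3ⁿ≢0 : NonZero (4 ^ (3 ^ n))
    4^3ⁿ≢0 = m^n≢0 4 (3 ^ n)
  x≈log₂K : x ≈ log₂ K
  x≈log₂K = begin
    x                           ≈⟨ +ℝ-congʳ (log₂ 3 *ℝ fromℕ n) (log₂ (3 ^ n)) (fromℕ 1) (log₂-*ℝ 3 n) ⟩
    log₂ (3 ^ n) +ℝ fromℕ 1     ≈⟨ log₂-+1 (3 ^ n) ⟩
    log₂ K                      ∎
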